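{- For any $3$-regular graph $G$ on $n$ vertices, $\lfloor\frac{n}{4}\rfloor+4$ cops suffice to catch the robber; that is, $\mathrm{ent}(G)\le\lfloor\frac{n}{4}\rfloor+4$.
   Context: Graphs here are finite, simple and undirected. Entanglement game on a graph $G$ with $k$ cops: First the robber chooses a starting vertex, and all $k$ cops are outside the graph. In every turn, the cops either all stay where they are, or exactly one of them flies (from wherever it is, on or off the graph) to the current position of the robber. Regardless of which of these happened, the robber then has to move to a neighbor of his current position that is not occupied by a cop. If there is no such neighbor, the cops win. The robber wins if he can run away indefinitely. Both sides have full information. The entanglement number $\mathrm{ent}(G)$ is the minimal integer $k$ such that $k$ cops have a strategy to catch the robber on $G$. -}

module Defs where

open import Level using (0ℓ)
open import Data.Nat using (ℕ; _≤_)
open import Data.Fin using (Fin)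
open import Data.List using (length; filter; allFin)
open import Data.Maybe using (Maybe; just; nothing)
open import Data.Vec using (Vec; replicate; _[_]≔_)
open import Data.Vec.Membership.Propositional using (_∉_)
open import Data.Product using (_×_)
open import Relation.Binary using (Rel; Decidable; Symmetric; Irreflexive)
open import Relation.Binary.PropositionalEquality using (_≡_)

record Graph (n : ℕ) : Set₁ where
  infix 4 _~_ _~?_
  field
    _~_      : Rel (Fin n) 0ℓ
    _~?_     : Decidable _~_
    ~-sym    : Symmetric _~_
    ~-irrefl : Irreflexive _≡_ _~_

  degree : Fin n → ℕ
  degree v = length (filter (v ~?_) (allFin n))

Regular : ∀ {n} → ℕ → Graph n → Set
Regular d G = ∀ v → Graph.degree G v ≡ d

-- Where each of the k cops is; `nothing` means outside the graph.
Cops : ℕ → ℕ → Set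
Cops n k = Vec (Maybe (Fin n)) k

data CopMove (k : ℕ) : Set where
  stay : CopMove k
  fly  : Fin k → CopMove k

-- A flying cop always lands on the robber's current vertex r.
play : ∀ {n k} → CopMove k → Cops n k → Fin n → Cops n k
play stay    c r = c
play (fly i) c r = c [ i ]≔ just r

module _ {n : ℕ} (G : Graph n) where
  open Graph G

  RobberMove : ∀ {k} → Cops n k → Fin n → Fin n → Set
  RobberMove c r r′ = (r ~ r′) × (just r′ ∉ c)

  -- A winning strategy for the cops, who are to move with the cops at c and
  -- the robber at r: a cop move together with a winning continuation for each
  -- legal reply of the robber.  Being inductive, the strategy tree has no
  -- infinite branch, so every play following it ends with the robber unable
  -- to move.  Different histories are different nodes of the tree, so the
  -- cops' choices may depend on the whole history.
  data WinningStrategy {k : ℕ} (c : Cops n k) (r : Fin n) : Set where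
    turn : (m : CopMove k) →
           (∀ r′ → RobberMove (play m c r) r r′ →
                   WinningStrategy (play m c r) r′) →
           WinningStrategy c r

  CopsSuffice : ℕ → Set
  CopsSuffice k = ∀ (start : Fin n) → WinningStrategy (replicate k nothing) start

  -- ent(G) = k, given as a relation: k is the least number of cops that suffices.
  IsEntanglement : ℕ → Set
  IsEntanglement k = CopsSuffice k × (∀ j → CopsSuffice j → k ≤ j)

{-# OPTIONS --safe #-}
-- For a vertex set Y of G let f(Y) be the number of edges minus the number of vertices
-- induced by Y.  It is supermodular, it can only grow when a connected set absorbs a
-- neighbour, and it is at most n/2 in a cubic graph.  The cops keep the robber inside a
-- connected territory K; whenever he steps on a vertex v such that every remaining
-- component at v has f ≤ f(K) − 2, a cop stays there for good.  This happens at most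
-- about n/4 times, because a connected U with f(U) ≥ 2 always contains such a vertex.
-- So while the robber avoids them he is in a connected U with f(U) ≤ 1.  There the same
-- idea with drop 1 (deleting cycle vertices) costs at most two more cops, and what
-- remains is a forest, where two cops chasing him in turns never let him backtrack.
module Submission where

open import Data.Bool using (Bool; true; false; not; _∧_; _∨_; if_then_else_)
open import Data.Bool.Properties using (∧-zeroʳ)
open import Data.Empty using (⊥-elim)
open import Data.Fin using (Fin; zero; suc; toℕ; fromℕ<)
open import Data.Fin.Properties using (_≟_; _<?_; <-cmp; <-irrefl; any?; toℕ-fromℕ<)
open import Data.Fin.Subset
open import Data.Fin.Subset.Induction using (Acc; acc; ⊂-wellFounded; ⊃-wellFounded)
open import Data.Fin.Subset.Properties
open import Data.List using (length; filter)
import Data.List as List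
open import Data.Maybe using (just)
open import Data.Nat using (ℕ; zero; suc; _+_; _*_; _≤_; _<_; _≤?_; z≤n; s≤s)
open import Data.Nat.DivMod using (_/_; _%_; m≡m%n+[m/n]*n; m%n<n)
open import Data.Nat.Properties hiding (_≟_; _≤?_; _<?_; <-cmp; <-irrefl)
open import Data.Nat.Tactic.RingSolver using (solve-∀)
open import Data.Product using (∃; ∃₂; _×_; _,_; proj₁; proj₂)
open import Data.Sum using (_⊎_; inj₁; inj₂; swap)
open import Data.Unit using (tt) renaming (⊤ to Unit)
open import Data.Vec using (lookup; []; _∷_; there; _[_]≔_)
import Data.Vec.Membership.Propositional as Vec
open import Data.Vec.Membership.Propositional.Properties using (∈-lookup)
open import Data.Vec.Properties
  using ([]=⇒lookup; lookup⇒[]=; lookup-zipWith; lookup-replicate; lookup∘update; lookup∘update′)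
open import Function using (_∘_; id)
open import Level using (0ℓ)
open import Relation.Binary.Definitions using (tri<; tri≈; tri>)
open import Relation.Binary.PropositionalEquality
open import Relation.Nullary using (¬_; Dec; yes; no; does; contradiction)
open import Relation.Nullary.Decidable using (dec-true; dec-false; _×-dec_; ¬?; decidable-stable)
open import Relation.Unary using (Pred; Decidable)
open import Defs

import Algebra.Properties.CommutativeMonoid.Sum as CommutativeMonoidSum
open CommutativeMonoidSum +-0-commutativeMonoid
  using (sum; sum-cong-≗; sum-replicate-zero; ∑-distrib-+; ∑-comm)

private
  variable
    n : ℕ

-- Indicators and finite sums of naturals

χ : Bool → ℕ
χ b = if b then 1 else 0

sum-const : ∀ n c → sum {n} (λ _ → c) ≡ n * c
sum-const zero    c = refl
sum-const (suc n) c = cong (c +_) (sum-const n c)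

sum-mono : {f g : Fin n → ℕ} → (∀ i → f i ≤ g i) → sum f ≤ sum g
sum-mono {zero}  f≤g = z≤n
sum-mono {suc n} f≤g = +-mono-≤ (f≤g zero) (sum-mono (f≤g ∘ suc))

entry≤sum : (f : Fin n → ℕ) (i : Fin n) → f i ≤ sum f
entry≤sum f zero    = m≤m+n _ _
entry≤sum f (suc i) = ≤-trans (entry≤sum (f ∘ suc) i) (m≤n+m _ _)

entries≤sum : (f : Fin n → ℕ) {i j : Fin n} → i ≢ j → f i + f j ≤ sum f
entries≤sum f {zero}  {zero}  i≢j = contradiction refl i≢j
entries≤sum f {zero}  {suc j} i≢j = +-monoʳ-≤ (f zero) (entry≤sum (f ∘ suc) j)
entries≤sum f {suc i} {zero}  i≢j =
  subst (_≤ sum f) (+-comm (f zero) _) (+-monoʳ-≤ (f zero) (entry≤sum (f ∘ suc) i))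
entries≤sum f {suc i} {suc j} i≢j =
  ≤-trans (entries≤sum (f ∘ suc) (i≢j ∘ cong suc)) (m≤n+m _ _)

∑∑ : (Fin n → Fin n → ℕ) → ℕ
∑∑ f = sum (λ i → sum (f i))

∑∑-cong : {f g : Fin n → Fin n → ℕ} → (∀ i j → f i j ≡ g i j) → ∑∑ f ≡ ∑∑ g
∑∑-cong f≗g = sum-cong-≗ (λ i → sum-cong-≗ (f≗g i))

∑∑-+ : (f g : Fin n → Fin n → ℕ) → ∑∑ (λ i j → f i j + g i j) ≡ ∑∑ f + ∑∑ g
∑∑-+ f g = trans (sum-cong-≗ (λ i → ∑-distrib-+ (f i) (g i))) (∑-distrib-+ (λ i → sum (f i)) (λ i → sum (g i)))

∑∑-zero : {f : Fin n → Fin n → ℕ} → (∀ i j → f i j ≡ 0) → ∑∑ f ≡ 0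
∑∑-zero {n} f≡0 =
  trans (sum-cong-≗ (λ i → trans (sum-cong-≗ (f≡0 i)) (sum-replicate-zero n)))
        (sum-replicate-zero n)

length-filter-tabulate : {A : Set} {P : Pred A 0ℓ} (P? : Decidable P) (f : Fin n → A) →
  length (filter P? (List.tabulate f)) ≡ sum (λ i → χ (does (P? (f i))))
length-filter-tabulate {zero}  P? f = refl
length-filter-tabulate {suc n} P? f with does (P? (f zero))
... | true  = cong suc (length-filter-tabulate P? (f ∘ suc))
... | false = length-filter-tabulate P? (f ∘ suc)

-- Finite subsets

∈⇒true : {x : Fin n} {Y : Subset n} → x ∈ Y → lookup Y x ≡ true
∈⇒true = []=⇒lookup

∉⇒false : {x : Fin n} {Y : Subset n} → x ∉ Y → lookup Y x ≡ false
∉⇒false {x = x} {Y} x∉Y with lookup Y x in eq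
... | true  = contradiction (lookup⇒[]= x Y eq) x∉Y
... | false = refl

search : {P : Subset n → Set} → (∀ Y → Dec (P Y)) → (∃ λ Y → P Y) ⊎ (∀ Y → ¬ P Y)
search P? with anySubset? P?
... | yes ∃P = inj₁ ∃P
... | no ¬∃P = inj₂ (λ Y pY → ¬∃P (Y , pY))

coSize+size : (Y : Subset n) → sum (λ i → χ (not (lookup Y i))) + ∣ Y ∣ ≡ n
coSize+size []            = refl
coSize+size (inside  ∷ Y) = trans (+-suc _ ∣ Y ∣) (cong suc (coSize+size Y))
coSize+size (outside ∷ Y) = cong suc (coSize+size Y)

∪-⊆ : {A B K : Subset n} → A ⊆ K → B ⊆ K → A ∪ B ⊆ K
∪-⊆ {A = A} {B} A⊆K B⊆K x∈ with x∈p∪q⁻ A B x∈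
... | inj₁ x∈A = A⊆K x∈A
... | inj₂ x∈B = B⊆K x∈B

⁅⁆-⊆ : {x : Fin n} {K : Subset n} → x ∈ K → ⁅ x ⁆ ⊆ K
⁅⁆-⊆ {x = x} x∈K y∈ rewrite x∈⁅y⁆⇒x≡y x y∈ = x∈K

x∈p─q⇒x∉q : {x : Fin n} {p q : Subset n} → x ∈ p ─ q → x ∉ q
x∈p─q⇒x∉q {x = zero}  {_ ∷ _} {inside  ∷ _} ()
x∈p─q⇒x∉q {x = zero}  {_ ∷ _} {outside ∷ _} _ ()
x∈p─q⇒x∉q {x = suc x} {_ ∷ p} {inside  ∷ q} (there x∈) (there x∈q) = x∈p─q⇒x∉q {p = p} x∈ x∈q
x∈p─q⇒x∉q {x = suc x} {_ ∷ p} {outside ∷ q} (there x∈) (there x∈q) = x∈p─q⇒x∉q {p = p} x∈ x∈q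

x∉p-x : {x : Fin n} {p : Subset n} → x ∉ p - x
x∉p-x {x = x} {p} x∈ = x∈p─q⇒x∉q {p = p} x∈ (x∈⁅x⁆ x)

p-x⊆p : {x : Fin n} {p : Subset n} → p - x ⊆ p
p-x⊆p {x = x} {p} = p─q⊆p p ⁅ x ⁆

p⊂p∪⁅x⁆ : {x : Fin n} {p : Subset n} → x ∉ p → p ⊂ p ∪ ⁅ x ⁆
p⊂p∪⁅x⁆ {x = x} {p} x∉p = p⊆p∪q ⁅ x ⁆ , x , q⊆p∪q p ⁅ x ⁆ (x∈⁅x⁆ x) , x∉p

disjoint⇒∩≡⊥ : {A B : Subset n} → (∀ {x} → x ∈ A → x ∉ B) → A ∩ B ≡ ⊥
disjoint⇒∩≡⊥ {A = A} {B} disj =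
  Empty-unique λ { (x , x∈) → let x∈A , x∈B = x∈p∩q⁻ A B x∈ in disj x∈A x∈B }

module CopStrategy (G : Graph n) where
  open Graph G

  -- Edge counts and supermodularity

  adj : Fin n → Fin n → Bool
  adj i j = does (i ~? j)

  -- Each edge is counted once, at its larger endpoint.
  arc : Fin n → Fin n → Bool
  arc i j = does (j <? i) ∧ adj i j

  adj-true : ∀ {i j} → i ~ j → adj i j ≡ true
  adj-true {i} {j} = dec-true (i ~? j)

  adj-false : ∀ {i j} → ¬ (i ~ j) → adj i j ≡ false
  adj-false {i} {j} = dec-false (i ~? j)

  adj-sym : ∀ i j → adj i j ≡ adj j i
  adj-sym i j with j ~? i
  ... | yes j~i = adj-true (~-sym j~i)
  ... | no  j≁i = adj-false (j≁i ∘ ~-sym)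

  arc-split : ∀ i j → χ (adj i j) ≡ χ (arc i j) + χ (arc j i)
  arc-split i j with <-cmp i j
  ... | tri< i<j _ j≮i rewrite dec-true (i <? j) i<j | dec-false (j <? i) j≮i =
    cong χ (adj-sym i j)
  ... | tri≈ i≮i refl _ rewrite dec-false (i <? i) i≮i | adj-false (~-irrefl {i} refl) = refl
  ... | tri> i≮j _ j<i rewrite dec-false (i <? j) i≮j | dec-true (j <? i) j<i =
    sym (+-identityʳ _)

  edges : Subset n → ℕ
  edges Y = ∑∑ (λ i j → χ (lookup Y i ∧ lookup Y j ∧ arc i j))

  coSize : Subset n → ℕ
  coSize Y = sum (λ i → χ (not (lookup Y i)))

  -- Edges minus vertices of the subgraph induced by Y, shifted by n to stay in ℕ.
  φ : Subset n → ℕ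
  φ Y = edges Y + coSize Y

  degreeIn : Subset n → Fin n → ℕ
  degreeIn Y i = sum (λ j → χ (lookup Y j ∧ adj i j))

  handshake : ∀ Y → sum (λ i → if lookup Y i then degreeIn Y i else 0) ≡ edges Y + edges Y
  handshake Y = begin
    sum (λ i → if lookup Y i then degreeIn Y i else 0)
      ≡⟨ sum-cong-≗ (λ i → inner i (lookup Y i)) ⟩
    ∑∑ (λ i j → χ (lookup Y i ∧ lookup Y j ∧ adj i j))
      ≡⟨ ∑∑-cong (λ i j → split (lookup Y i) (lookup Y j) _ _ _ (arc-split i j)) ⟩
    ∑∑ (λ i j → χ (lookup Y i ∧ lookup Y j ∧ arc i j) + χ (lookup Y j ∧ lookup Y i ∧ arc j i))
      ≡⟨ ∑∑-+ (λ i j → χ (lookup Y i ∧ lookup Y j ∧ arc i j)) _ ⟩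
    edges Y + ∑∑ (λ i j → χ (lookup Y j ∧ lookup Y i ∧ arc j i))
      ≡⟨ cong (edges Y +_) (∑-comm (λ i j → χ (lookup Y j ∧ lookup Y i ∧ arc j i))) ⟩
    edges Y + edges Y ∎
    where
    open ≡-Reasoning
    inner : ∀ i b → (if b then degreeIn Y i else 0) ≡ sum (λ j → χ (b ∧ lookup Y j ∧ adj i j))
    inner i true  = refl
    inner i false = sym (sum-replicate-zero n)
    split : ∀ a b x y z → χ x ≡ χ y + χ z → χ (a ∧ b ∧ x) ≡ χ (a ∧ b ∧ y) + χ (b ∧ a ∧ z)
    split true  true  x y z eq = eq
    split true  false x y z eq = refl
    split false true  x y z eq = refl
    split false false x y z eq = refl

  -- Adjacent pairs of this kind are the edges of `A ∪ B` that lie in neither `A` nor `B`: the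
  -- defect of modularity. Both orientations appear because `arc` only runs from the larger index to
  -- the smaller.
  cross : Subset n → Subset n → Fin n → Fin n → Bool
  cross A B i j =
    (lookup A i ∧ not (lookup B i)) ∧ (lookup B j ∧ not (lookup A j))
    ∨ (lookup B i ∧ not (lookup A i)) ∧ (lookup A j ∧ not (lookup B j))

  crossEdges : Subset n → Subset n → ℕ
  crossEdges A B = ∑∑ (λ i j → χ (cross A B i j ∧ arc i j))

  edges-modular : ∀ A B → edges A + edges B + crossEdges A B ≡ edges (A ∪ B) + edges (A ∩ B)
  edges-modular A B = begin
    edges A + edges B + crossEdges A B
      ≡⟨ cong (_+ crossEdges A B) (sym (∑∑-+ (λ i j → χ (lookup A i ∧ lookup A j ∧ arc i j)) _)) ⟩
    ∑∑ (λ i j → χ (lookup A i ∧ lookup A j ∧ arc i j) + χ (lookup B i ∧ lookup B j ∧ arc i j))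
      + crossEdges A B
      ≡⟨ sym (∑∑-+ (λ i j → χ (lookup A i ∧ lookup A j ∧ arc i j) + χ (lookup B i ∧ lookup B j ∧ arc i j)) _) ⟩
    ∑∑ (λ i j → χ (lookup A i ∧ lookup A j ∧ arc i j) + χ (lookup B i ∧ lookup B j ∧ arc i j)
              + χ (cross A B i j ∧ arc i j))
      -- The two sides agree pair by pair, by a truth table in the memberships of `i` and `j` and
      -- the value of `arc i j`.
      ≡⟨ ∑∑-cong (λ i j → trans (pointwise (lookup A i) (lookup A j) (lookup B i) (lookup B j) (arc i j))
           (cong₂ _+_
             (cong₂ (λ x y → χ (x ∧ y ∧ arc i j))
               (sym (lookup-zipWith _∨_ i A B)) (sym (lookup-zipWith _∨_ j A B)))
             (cong₂ (λ x y → χ (x ∧ y ∧ arc i j))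
               (sym (lookup-zipWith _∧_ i A B)) (sym (lookup-zipWith _∧_ j A B))))) ⟩
    ∑∑ (λ i j → χ (lookup (A ∪ B) i ∧ lookup (A ∪ B) j ∧ arc i j)
              + χ (lookup (A ∩ B) i ∧ lookup (A ∩ B) j ∧ arc i j))
      ≡⟨ ∑∑-+ (λ i j → χ (lookup (A ∪ B) i ∧ lookup (A ∪ B) j ∧ arc i j)) _ ⟩
    edges (A ∪ B) + edges (A ∩ B) ∎
    where
    open ≡-Reasoning
    pointwise : ∀ a a′ b b′ l →
      χ (a ∧ a′ ∧ l) + χ (b ∧ b′ ∧ l)
        + χ (((a ∧ not b) ∧ (b′ ∧ not a′) ∨ (b ∧ not a) ∧ (a′ ∧ not b′)) ∧ l)
      ≡ χ ((a ∨ b) ∧ (a′ ∨ b′) ∧ l) + χ ((a ∧ b) ∧ (a′ ∧ b′) ∧ l)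
    pointwise true  true  true  true  true  = refl
    pointwise true  true  true  true  false = refl
    pointwise true  true  true  false true  = refl
    pointwise true  true  true  false false = refl
    pointwise true  true  false true  true  = refl
    pointwise true  true  false true  false = refl
    pointwise true  true  false false true  = refl
    pointwise true  true  false false false = refl
    pointwise true  false true  true  true  = refl
    pointwise true  false true  true  false = refl
    pointwise true  false true  false _     = refl
    pointwise true  false false true  true  = refl
    pointwise true  false false true  false = refl
    pointwise true  false false false _     = refl
    pointwise false true  true  true  true  = refl
    pointwise false true  true  true  false = refl
    pointwise false true  true  false true  = refl
    pointwise false true  true  false false = refl
    pointwise false true  false true  _     = refl
    pointwise false true  false false _     = refl
    pointwise false false true  true  true  = refl
    pointwise false false true  true  false = refl
    pointwise false false true  false _     = refl
    pointwise false false false true  _     = refl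
    pointwise false false false false _     = refl

  coSize-modular : ∀ A B → coSize A + coSize B ≡ coSize (A ∪ B) + coSize (A ∩ B)
  coSize-modular A B = begin
    coSize A + coSize B
      ≡⟨ sym (∑-distrib-+ (λ i → χ (not (lookup A i))) _) ⟩
    sum (λ i → χ (not (lookup A i)) + χ (not (lookup B i)))
      ≡⟨ sum-cong-≗ (λ i → trans (pointwise (lookup A i) (lookup B i))
           (cong₂ (λ x y → χ (not x) + χ (not y))
             (sym (lookup-zipWith _∨_ i A B)) (sym (lookup-zipWith _∧_ i A B)))) ⟩
    sum (λ i → χ (not (lookup (A ∪ B) i)) + χ (not (lookup (A ∩ B) i)))
      ≡⟨ ∑-distrib-+ (λ i → χ (not (lookup (A ∪ B) i))) _ ⟩
    coSize (A ∪ B) + coSize (A ∩ B) ∎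
    where
    open ≡-Reasoning
    pointwise : ∀ a b → χ (not a) + χ (not b) ≡ χ (not (a ∨ b)) + χ (not (a ∧ b))
    pointwise true  true  = refl
    pointwise true  false = refl
    pointwise false true  = refl
    pointwise false false = refl

  φ-modular : ∀ A B → φ A + φ B + crossEdges A B ≡ φ (A ∪ B) + φ (A ∩ B)
  φ-modular A B = begin
    φ A + φ B + crossEdges A B
      ≡⟨ shuffle (edges A) (coSize A) (edges B) (coSize B) (crossEdges A B) ⟩
    (edges A + edges B + crossEdges A B) + (coSize A + coSize B)
      ≡⟨ cong₂ _+_ (edges-modular A B) (coSize-modular A B) ⟩
    (edges (A ∪ B) + edges (A ∩ B)) + (coSize (A ∪ B) + coSize (A ∩ B))
      ≡⟨ shuffle′ (edges (A ∪ B)) (edges (A ∩ B)) (coSize (A ∪ B)) (coSize (A ∩ B)) ⟩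
    φ (A ∪ B) + φ (A ∩ B) ∎
    where
    open ≡-Reasoning
    shuffle : ∀ a b c d e → (a + b) + (c + d) + e ≡ (a + c + e) + (b + d)
    shuffle = solve-∀
    shuffle′ : ∀ a b c d → (a + b) + (c + d) ≡ (a + c) + (b + d)
    shuffle′ = solve-∀

  φ-supermodular : ∀ A B → φ A + φ B ≤ φ (A ∪ B) + φ (A ∩ B)
  φ-supermodular A B = ≤-trans (m≤m+n _ _) (≤-reflexive (φ-modular A B))

  -- The edge is counted in `crossEdges`, in one of its two orientations, so the defect is at least
  -- one.
  φ-supermodular-edge : ∀ {A B x y} → x ∈ A → x ∉ B → y ∈ B → y ∉ A → x ~ y →
    φ A + φ B + 1 ≤ φ (A ∪ B) + φ (A ∩ B)
  φ-supermodular-edge {A} {B} {x} {y} x∈A x∉B y∈B y∉A x~y =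
    subst (φ A + φ B + 1 ≤_) (φ-modular A B) (+-monoʳ-≤ (φ A + φ B) positive)
    where
    entry : ∀ {i j} → 1 ≤ χ (cross A B i j ∧ arc i j) → 1 ≤ crossEdges A B
    entry {i} {j} 1≤ =
      ≤-trans 1≤ (≤-trans (entry≤sum (λ v → χ (cross A B i v ∧ arc i v)) j)
                          (entry≤sum (λ u → sum (λ v → χ (cross A B u v ∧ arc u v))) i))
    positive : 1 ≤ crossEdges A B
    positive with <-cmp x y
    ... | tri≈ _ x≡y _ = ⊥-elim (~-irrefl x≡y x~y)
    ... | tri> _ _ y<x = entry {x} {y} at-xy
      where
      at-xy : 1 ≤ χ (cross A B x y ∧ arc x y)
      at-xy rewrite ∈⇒true x∈A | ∉⇒false x∉B | ∈⇒true y∈B | ∉⇒false y∉A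
                  | dec-true (y <? x) y<x | adj-true x~y = s≤s z≤n
    ... | tri< x<y _ _ = entry {y} {x} at-yx
      where
      at-yx : 1 ≤ χ (cross A B y x ∧ arc y x)
      at-yx rewrite ∈⇒true x∈A | ∉⇒false x∉B | ∈⇒true y∈B | ∉⇒false y∉A
                  | dec-true (x <? y) x<y | adj-true (~-sym x~y) = s≤s z≤n

  φ-additive : ∀ {A B} → (∀ {x y} → x ∈ A → y ∈ B → ¬ (x ~ y)) →
    φ (A ∪ B) + φ (A ∩ B) ≡ φ A + φ B
  φ-additive {A} {B} apart =
    trans (sym (φ-modular A B)) (trans (cong (φ A + φ B +_) (∑∑-zero vanish)) (+-identityʳ _))
    where
    vanish : ∀ i j → χ (cross A B i j ∧ arc i j) ≡ 0
    vanish i j with i ~? j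
    ... | no _ rewrite ∧-zeroʳ (does (j <? i)) | ∧-zeroʳ (cross A B i j) = refl
    ... | yes i~j with i ∈? A | j ∈? B | i ∈? B | j ∈? A
    ... | yes i∈A | yes j∈B | _ | _ = ⊥-elim (apart i∈A j∈B i~j)
    ... | _ | _ | yes i∈B | yes j∈A = ⊥-elim (apart j∈A i∈B (~-sym i~j))
    ... | no i∉A | _ | no i∉B | _ rewrite ∉⇒false i∉A | ∉⇒false i∉B = refl
    ... | no i∉A | _ | yes _ | no j∉A rewrite ∉⇒false i∉A | ∉⇒false j∉A
      | ∧-zeroʳ (lookup B i ∧ true) = refl
    ... | yes _ | no j∉B | no i∉B | _ rewrite ∉⇒false j∉B | ∉⇒false i∉B
      | ∧-zeroʳ (lookup A i ∧ true) = refl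
    ... | yes i∈A | no j∉B | yes i∈B | no _ rewrite ∈⇒true i∈A | ∈⇒true i∈B = refl

  φ⊥≡n : φ ⊥ ≡ n
  φ⊥≡n = cong₂ _+_ (∑∑-zero no-edge) (trans (sum-cong-≗ outside-⊥) (trans (sum-const n 1) (*-identityʳ n)))
    where
    no-edge : ∀ i j → χ (lookup {n = n} ⊥ i ∧ lookup {n = n} ⊥ j ∧ arc i j) ≡ 0
    no-edge i j rewrite lookup-replicate i outside = refl
    outside-⊥ : ∀ i → χ (not (lookup {n = n} ⊥ i)) ≡ 1
    outside-⊥ i rewrite lookup-replicate i outside = refl

  -- A single vertex has f = -1, whereas the empty set has f = 0; the `+ 1` avoids truncated
  -- subtraction.
  φ⁅⁆+1≡n : ∀ x → φ ⁅ x ⁆ + 1 ≡ n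
  φ⁅⁆+1≡n x = begin
    edges ⁅ x ⁆ + coSize ⁅ x ⁆ + 1  ≡⟨ cong (λ e → e + coSize ⁅ x ⁆ + 1) (∑∑-zero no-edge) ⟩
    coSize ⁅ x ⁆ + 1                ≡⟨ cong (coSize ⁅ x ⁆ +_) (sym (∣⁅x⁆∣≡1 x)) ⟩
    coSize ⁅ x ⁆ + ∣ ⁅ x ⁆ ∣        ≡⟨ coSize+size ⁅ x ⁆ ⟩
    n                               ∎
    where
    open ≡-Reasoning
    no-edge : ∀ i j → χ (lookup ⁅ x ⁆ i ∧ lookup ⁅ x ⁆ j ∧ arc i j) ≡ 0
    no-edge i j with i ∈? ⁅ x ⁆ | j ∈? ⁅ x ⁆
    ... | no i∉ | _ rewrite ∉⇒false i∉ = refl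
    ... | yes _ | no j∉ rewrite ∉⇒false j∉ | ∧-zeroʳ (lookup ⁅ x ⁆ i) = refl
    ... | yes i∈ | yes j∈ with x∈⁅y⁆⇒x≡y x i∈ | x∈⁅y⁆⇒x≡y x j∈
    ... | refl | refl rewrite dec-false (x <? x) (<-irrefl refl)
      | ∧-zeroʳ (lookup ⁅ x ⁆ x) | ∧-zeroʳ (lookup ⁅ x ⁆ x) = refl

  -- Degree sums

  -- By `handshake`; a vertex outside `Y` adds 1 to `coSize`, hence 2 after doubling. Degree bounds
  -- thereby become bounds on `φ`.
  2φ : ∀ Y → φ Y + φ Y ≡ sum (λ i → if lookup Y i then degreeIn Y i else 2)
  2φ Y = begin
    φ Y + φ Y
      ≡⟨ shuffle (edges Y) (coSize Y) ⟩
    (edges Y + edges Y) + (coSize Y + coSize Y)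
      ≡⟨ cong₂ _+_ (sym (handshake Y)) (sym (∑-distrib-+ co co)) ⟩
    sum inn + sum (λ i → co i + co i)
      ≡⟨ sym (∑-distrib-+ inn (λ i → co i + co i)) ⟩
    sum (λ i → inn i + (co i + co i))
      ≡⟨ sum-cong-≗ (λ i → pointwise (lookup Y i) (degreeIn Y i)) ⟩
    sum (λ i → if lookup Y i then degreeIn Y i else 2) ∎
    where
    open ≡-Reasoning
    co inn : Fin n → ℕ
    co i = χ (not (lookup Y i))
    inn i = if lookup Y i then degreeIn Y i else 0
    shuffle : ∀ a b → (a + b) + (a + b) ≡ (a + a) + (b + b)
    shuffle = solve-∀
    pointwise : ∀ b d → (if b then d else 0) + (χ (not b) + χ (not b)) ≡ (if b then d else 2)
    pointwise true  d = +-identityʳ d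
    pointwise false d = refl

  degreeIn≤degree : ∀ Y v → degreeIn Y v ≤ degree v
  degreeIn≤degree Y v =
    subst (degreeIn Y v ≤_) (sym (length-filter-tabulate (v ~?_) id))
          (sum-mono (λ j → bound (lookup Y j) (adj v j)))
    where
    bound : ∀ a b → χ (a ∧ b) ≤ χ b
    bound true  b = ≤-refl
    bound false b = z≤n

  2φ≤3n : Regular 3 G → ∀ Y → φ Y + φ Y ≤ n * 3
  2φ≤3n reg Y = subst₂ _≤_ (sym (2φ Y)) (sum-const n 3) (sum-mono (λ i → bound i (lookup Y i)))
    where
    bound : ∀ i b → (if b then degreeIn Y i else 2) ≤ 3
    bound i true  = subst (degreeIn Y i ≤_) (reg i) (degreeIn≤degree Y i)
    bound i false = s≤s (s≤s z≤n)

  -- Isolated vertices are included.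
  Leaf : Subset n → Fin n → Set
  Leaf Y v = ∀ {u w} → u ∈ Y → w ∈ Y → v ~ u → v ~ w → u ≡ w

  2≤degreeIn : ∀ {Y v u w} → u ∈ Y → w ∈ Y → v ~ u → v ~ w → u ≢ w → 2 ≤ degreeIn Y v
  2≤degreeIn {Y} {v} u∈ w∈ v~u v~w u≢w =
    subst₂ (λ a b → a + b ≤ degreeIn Y v) (one u∈ v~u) (one w∈ v~w) (entries≤sum _ u≢w)
    where
    one : ∀ {x} → x ∈ Y → v ~ x → χ (lookup Y x ∧ adj v x) ≡ 1
    one x∈ v~x rewrite ∈⇒true x∈ | adj-true v~x = refl

  -- If every vertex of `Y` had two neighbours in `Y`, every summand in `2φ` would be at least 2,
  -- forcing `n ≤ φ Y`.
  leaf-exists : ∀ {Y} → φ Y < n → ∃ λ v → v ∈ Y × Leaf Y v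
  leaf-exists {Y} φY<n with any? (λ v → v ∈? Y ×-dec ¬? (branching? v))
    where
    Branching : Fin n → Set
    Branching v = ∃ λ u → ∃ λ w → (u ∈ Y × w ∈ Y) × (v ~ u × v ~ w) × u ≢ w
    branching? : Decidable Branching
    branching? v = any? λ u → any? λ w →
      (u ∈? Y ×-dec w ∈? Y) ×-dec (v ~? u ×-dec v ~? w) ×-dec ¬? (u ≟ w)
  ... | yes (v , v∈ , ¬br) = v , v∈ , λ {u} {w} u∈ w∈ v~u v~w →
        decidable-stable (u ≟ w) (λ u≢w → ¬br (u , w , (u∈ , w∈) , (v~u , v~w) , u≢w))
  ... | no all-br = contradiction (+-mono-< φY<n φY<n) (≤⇒≯ 2n≤2φ)
    where
    bound : ∀ i → 2 ≤ (if lookup Y i then degreeIn Y i else 2)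
    bound i with i ∈? Y
    ... | no  i∉ rewrite ∉⇒false i∉ = ≤-refl
    ... | yes i∈ rewrite ∈⇒true i∈ = ≮⇒≥ λ d<2 → all-br
          (i , i∈ , λ { (u , w , (u∈ , w∈) , (v~u , v~w) , u≢w) →
            <⇒≱ d<2 (2≤degreeIn u∈ w∈ v~u v~w u≢w) })
    2n≤2φ : n + n ≤ φ Y + φ Y
    2n≤2φ = subst₂ _≤_ (trans (sum-const n 2) (trans (*-comm n 2) (cong (n +_) (+-identityʳ n))))
                       (sym (2φ Y)) (sum-mono bound)

  -- Connectivity

  Crossing : Subset n → Subset n → Set
  Crossing K Z = ∃₂ λ u w → (u ∈ K × u ∈ Z) × (w ∈ K × w ∉ Z) × u ~ w

  -- Connectivity by cuts rather than paths: a set that splits `K` is crossed by an edge of `K`.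
  -- This edge is what the growth arguments below consume.
  Connected : Subset n → Set
  Connected K = ∀ Z {x y} → x ∈ K → x ∈ Z → y ∈ K → y ∉ Z → Crossing K Z

  connected-⁅⁆ : ∀ r → Connected ⁅ r ⁆
  connected-⁅⁆ r Z x∈ x∈Z y∈ y∉Z with x∈⁅y⁆⇒x≡y r x∈ | x∈⁅y⁆⇒x≡y r y∈
  ... | refl | refl = contradiction x∈Z y∉Z

  connected-grow : ∀ {K u w} → Connected K → u ∈ K → u ~ w → Connected (K ∪ ⁅ w ⁆)
  connected-grow {K} {u} {w} conn u∈K u~w Z {x} {y} x∈ x∈Z y∈ y∉Z
    with u ∈? Z | w ∈? Z
  ... | yes u∈Z | no  w∉Z =
    u , w , (p⊆p∪q _ u∈K , u∈Z) , (q⊆p∪q K _ (x∈⁅x⁆ w) , w∉Z) , u~w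
  ... | no  u∉Z | yes w∈Z =
    w , u , (q⊆p∪q K _ (x∈⁅x⁆ w) , w∈Z) , (p⊆p∪q _ u∈K , u∉Z) , ~-sym u~w
  ... | yes u∈Z | yes w∈Z with x∈p∪q⁻ K ⁅ w ⁆ y∈
  ...   | inj₂ y∈w rewrite x∈⁅y⁆⇒x≡y w y∈w = contradiction w∈Z y∉Z
  ...   | inj₁ y∈K with conn Z u∈K u∈Z y∈K y∉Z
  ...     | a , b , (a∈ , a∈Z) , (b∈ , b∉Z) , a~b =
    a , b , (p⊆p∪q _ a∈ , a∈Z) , (p⊆p∪q _ b∈ , b∉Z) , a~b
  connected-grow {K} {u} {w} conn u∈K u~w Z {x} {y} x∈ x∈Z y∈ y∉Z
      | no u∉Z | no w∉Z with x∈p∪q⁻ K ⁅ w ⁆ x∈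
  ...   | inj₂ x∈w rewrite x∈⁅y⁆⇒x≡y w x∈w = contradiction x∈Z w∉Z
  ...   | inj₁ x∈K with conn Z x∈K x∈Z u∈K u∉Z
  ...     | a , b , (a∈ , a∈Z) , (b∈ , b∉Z) , a~b =
    a , b , (p⊆p∪q _ a∈ , a∈Z) , (p⊆p∪q _ b∈ , b∉Z) , a~b

  record Component (P : Fin n → Set) (r : Fin n) : Set where
    field
      K         : Subset n
      root      : r ∈ K
      connected : Connected K
      within    : ∀ {u} → u ∈ K → P u
      closed    : ∀ {u w} → u ∈ K → P w → u ~ w → w ∈ K

  -- Starting from `r` alone, neighbours satisfying `P` are absorbed until none is left; a finite
  -- graph allows no infinite growth.
  component : ∀ {P r} → Decidable P → P r → Component P r
  component {P} {r} P? Pr =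
    grow (⊃-wellFounded ⁅ r ⁆) (x∈⁅x⁆ r) (connected-⁅⁆ r)
         (λ u∈ → subst P (sym (x∈⁅y⁆⇒x≡y r u∈)) Pr)
    where
    grow : ∀ {K} → Acc _⊃_ K → r ∈ K → Connected K → (∀ {u} → u ∈ K → P u) → Component P r
    grow {K} (acc rec) r∈K conn within
      with any? (λ u → any? λ w → (u ∈? K ×-dec ¬? (w ∈? K)) ×-dec (P? w ×-dec u ~? w))
    ... | yes (u , w , (u∈K , w∉K) , Pw , u~w) =
      grow (rec (p⊂p∪⁅x⁆ w∉K)) (p⊆p∪q _ r∈K) (connected-grow conn u∈K u~w) within′
      where
      within′ : ∀ {v} → v ∈ K ∪ ⁅ w ⁆ → P v
      within′ v∈ with x∈p∪q⁻ K ⁅ w ⁆ v∈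
      ... | inj₁ v∈K = within v∈K
      ... | inj₂ v∈w = subst P (sym (x∈⁅y⁆⇒x≡y w v∈w)) Pw
    ... | no stuck = record
      { K = K ; root = r∈K ; connected = conn ; within = within
      ; closed = λ {u} {w} u∈K Pw u~w → decidable-stable (w ∈? K)
          (λ w∉K → stuck (u , w , (u∈K , w∉K) , Pw , u~w)) }

  -- Growth of `φ` along edges

  -- Supermodularity with an edge and an empty intersection, whose value is `n`. Unshifted, f(A) +
  -- f(B) + 1 ≤ f(A ∪ B).
  φ-∪-edge : ∀ {A B x y} → (∀ {z} → z ∈ A → z ∉ B) → x ∈ A → y ∈ B → x ~ y →
    φ A + φ B + 1 ≤ φ (A ∪ B) + n
  φ-∪-edge {A} {B} disj x∈A y∈B x~y =
    subst (λ m → φ A + φ B + 1 ≤ φ (A ∪ B) + m) (trans (cong φ (disjoint⇒∩≡⊥ disj)) φ⊥≡n)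
      (φ-supermodular-edge x∈A (disj x∈A) y∈B (λ y∈A → disj y∈A y∈B) x~y)

  φ-grow : ∀ {Y x z} → x ∈ Y → z ∉ Y → x ~ z → φ Y ≤ φ (Y ∪ ⁅ z ⁆)
  φ-grow {Y} {x} {z} x∈Y z∉Y x~z = +-cancelʳ-≤ n (φ Y) (φ (Y ∪ ⁅ z ⁆)) (begin
    φ Y + n                ≡⟨ cong (φ Y +_) (sym (φ⁅⁆+1≡n z)) ⟩
    φ Y + (φ ⁅ z ⁆ + 1)    ≡⟨ sym (+-assoc (φ Y) (φ ⁅ z ⁆) 1) ⟩
    φ Y + φ ⁅ z ⁆ + 1      ≤⟨ φ-∪-edge (λ {u} u∈Y u∈z → z∉Y (subst (_∈ Y) (x∈⁅y⁆⇒x≡y z u∈z) u∈Y))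
                                x∈Y (x∈⁅x⁆ z) x~z ⟩
    φ (Y ∪ ⁅ z ⁆) + n      ∎)
    where open ≤-Reasoning

  -- While `Y` is not all of `K`, a cut edge leads to a vertex that `φ-grow` absorbs. `Y` must be
  -- nonempty: the empty set has f = 0, a tree only f = -1.
  φ-mono : ∀ {K Y} → Connected K → Nonempty Y → Y ⊆ K → φ Y ≤ φ K
  φ-mono {K} {Y} conn = go (⊃-wellFounded Y)
    where
    go : ∀ {Y} → Acc _⊃_ Y → Nonempty Y → Y ⊆ K → φ Y ≤ φ K
    go {Y} (acc rec) (x , x∈Y) Y⊆K with any? (λ u → u ∈? K ×-dec ¬? (u ∈? Y))
    ... | no full = ≤-reflexive (cong φ (⊆-antisym Y⊆K
            λ {u} u∈K → decidable-stable (u ∈? Y) (λ u∉Y → full (u , u∈K , u∉Y))))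
    ... | yes (y , y∈K , y∉Y) with conn Y (Y⊆K x∈Y) x∈Y y∈K y∉Y
    ... | u , w , (_ , u∈Y) , (w∈K , w∉Y) , u~w =
      ≤-trans (φ-grow u∈Y w∉Y u~w)
        (go (rec (p⊂p∪⁅x⁆ w∉Y)) (x , p⊆p∪q _ x∈Y) (∪-⊆ Y⊆K (⁅⁆-⊆ w∈K)))

  nonempty-of-φ : ∀ {Y} → n < φ Y → Nonempty Y
  nonempty-of-φ {Y} n<φY = decidable-stable (nonempty? Y)
    (λ empty → <⇒≢ n<φY (trans (sym φ⊥≡n) (cong φ (sym (Empty-unique empty)))))

  -- Otherwise `w` separates `U - w` into `W` and `Q`, both adjacent to `w`. Adding `w` to either
  -- side does not lower f, and the enlarged sides share only `w`, with f = -1; so f(U) ≥ f(W) +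
  -- f(Q) + 1 = f(U - w) + 1.
  connected-remove : ∀ {U w} → Connected U → w ∈ U → φ U ≤ φ (U - w) → Connected (U - w)
  connected-remove {U} {w} conn w∈U φU≤ Z {x} {y} x∈ x∈Z y∈ y∉Z
    with any? (λ u → any? λ v → (u ∈? (U - w) ×-dec u ∈? Z) ×-dec (v ∈? (U - w) ×-dec ¬? (v ∈? Z)) ×-dec u ~? v)
  ... | yes (u , v , crossing) = u , v , crossing
  ... | no none = contradiction φU≤ (<⇒≱ (arith (φ W) (φ Q) (φ (U - w)) (φ U) (φ ⁅ w ⁆) n
          additive (φ-grow p∈W w∉W p~w) (φ-grow q∈Q w∉Q q~w) super (φ⁅⁆+1≡n w)))
    where
    W Q : Subset n
    W = (U - w) ∩ Z
    Q = (U - w) ∩ ∁ Z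

    W⁻ : ∀ {u} → u ∈ W → u ∈ U - w × u ∈ Z
    W⁻ = x∈p∩q⁻ (U - w) Z
    Q⁻ : ∀ {u} → u ∈ Q → u ∈ U - w × u ∉ Z
    Q⁻ u∈ = let u∈U , u∈∁ = x∈p∩q⁻ (U - w) (∁ Z) u∈ in u∈U , x∈∁p⇒x∉p u∈∁

    w∉W : w ∉ W
    w∉W w∈ = x∉p-x {p = U} (proj₁ (W⁻ w∈))
    w∉Q : w ∉ Q
    w∉Q w∈ = x∉p-x {p = U} (proj₁ (Q⁻ w∈))

    apart : ∀ {u v} → u ∈ W → v ∈ Q → ¬ (u ~ v)
    apart {u} {v} u∈ v∈ u~v = none (u , v , W⁻ u∈ , Q⁻ v∈ , u~v)

    cover : ∀ {u} → u ∈ U → u ≢ w → u ∈ W ⊎ u ∈ Q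
    cover {u} u∈U u≢w with u ∈? Z
    ... | yes u∈Z = inj₁ (x∈p∩q⁺ (x∈p∧x≢y⇒x∈p-y u∈U u≢w , u∈Z))
    ... | no  u∉Z = inj₂ (x∈p∩q⁺ (x∈p∧x≢y⇒x∈p-y u∈U u≢w , x∉p⇒x∈∁p u∉Z))

    W∪Q : W ∪ Q ≡ U - w
    W∪Q = ⊆-antisym (∪-⊆ (proj₁ ∘ W⁻) (proj₁ ∘ Q⁻))
      λ {u} u∈ → x∈p∪q⁺ (cover (p-x⊆p {p = U} u∈) λ { refl → x∉p-x {p = U} u∈ })

    W∩Q : W ∩ Q ≡ ⊥
    W∩Q = disjoint⇒∩≡⊥ λ u∈W u∈Q → proj₂ (Q⁻ u∈Q) (proj₂ (W⁻ u∈W))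

    additive : φ (U - w) + n ≡ φ W + φ Q
    additive = subst₂ (λ A m → φ A + m ≡ φ W + φ Q) W∪Q (trans (cong φ W∩Q) φ⊥≡n) (φ-additive apart)

    -- An edge of `U` leaving `A` cannot end in `B`, so it ends at `w`.
    link : ∀ {A B} → A ⊆ U → (∀ {u} → u ∈ U → u ≢ w → u ∈ A ⊎ u ∈ B) →
      (∀ {u v} → u ∈ A → v ∈ B → ¬ (u ~ v)) → w ∉ A → Nonempty A →
      ∃ λ p → p ∈ A × p ~ w
    link {A} {B} A⊆U cov apt w∉A (a , a∈A) with conn A (A⊆U a∈A) a∈A w∈U w∉A
    ... | u , v , (_ , u∈A) , (v∈U , v∉A) , u~v with v ≟ w
    ... | yes refl = u , u∈A , u~v
    ... | no v≢w with cov v∈U v≢w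
    ... | inj₁ v∈A = contradiction v∈A v∉A
    ... | inj₂ v∈B = contradiction u~v (apt u∈A v∈B)

    linkW : ∃ λ p → p ∈ W × p ~ w
    linkW = link (p-x⊆p {p = U} ∘ proj₁ ∘ W⁻) cover apart w∉W (x , x∈p∩q⁺ (x∈ , x∈Z))
    linkQ : ∃ λ q → q ∈ Q × q ~ w
    linkQ = link {B = W} (p-x⊆p {p = U} ∘ proj₁ ∘ Q⁻) (λ u∈ u≢ → swap (cover u∈ u≢))
      (λ u∈ v∈ u~v → apart v∈ u∈ (~-sym u~v)) w∉Q (y , x∈p∩q⁺ (y∈ , x∉p⇒x∈∁p y∉Z))

    p∈W = proj₁ (proj₂ linkW)
    p~w = proj₂ (proj₂ linkW)
    q∈Q = proj₁ (proj₂ linkQ)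
    q~w = proj₂ (proj₂ linkQ)

    W⁺ = W ∪ ⁅ w ⁆
    Q⁺ = Q ∪ ⁅ w ⁆

    union : W⁺ ∪ Q⁺ ≡ U
    union = ⊆-antisym
      (∪-⊆ (∪-⊆ (p-x⊆p {p = U} ∘ proj₁ ∘ W⁻) (⁅⁆-⊆ w∈U)) (∪-⊆ (p-x⊆p {p = U} ∘ proj₁ ∘ Q⁻) (⁅⁆-⊆ w∈U)))
      back
      where
      back : U ⊆ W⁺ ∪ Q⁺
      back {u} u∈U with u ≟ w
      ... | yes refl = p⊆p∪q Q⁺ (q⊆p∪q W _ (x∈⁅x⁆ u))
      ... | no u≢w with cover u∈U u≢w
      ... | inj₁ u∈W = p⊆p∪q Q⁺ (p⊆p∪q _ u∈W)
      ... | inj₂ u∈Q = q⊆p∪q W⁺ Q⁺ (p⊆p∪q _ u∈Q)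

    inter : W⁺ ∩ Q⁺ ≡ ⁅ w ⁆
    inter = ⊆-antisym forth (⁅⁆-⊆ (x∈p∩q⁺ (q⊆p∪q W _ (x∈⁅x⁆ w) , q⊆p∪q Q _ (x∈⁅x⁆ w))))
      where
      forth : W⁺ ∩ Q⁺ ⊆ ⁅ w ⁆
      forth u∈ with x∈p∩q⁻ W⁺ Q⁺ u∈
      ... | u∈W⁺ , u∈Q⁺ with x∈p∪q⁻ W ⁅ w ⁆ u∈W⁺ | x∈p∪q⁻ Q ⁅ w ⁆ u∈Q⁺
      ... | inj₂ u∈w | _ = u∈w
      ... | _ | inj₂ u∈w = u∈w
      ... | inj₁ u∈W | inj₁ u∈Q = contradiction (proj₂ (W⁻ u∈W)) (proj₂ (Q⁻ u∈Q))

    super : φ W⁺ + φ Q⁺ ≤ φ U + φ ⁅ w ⁆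
    super = subst₂ (λ A B → φ W⁺ + φ Q⁺ ≤ φ A + φ B) union inter (φ-supermodular W⁺ Q⁺)

    arith : ∀ a b c d e m {a⁺ b⁺} → c + m ≡ a + b → a ≤ a⁺ → b ≤ b⁺ → a⁺ + b⁺ ≤ d + e → e + 1 ≡ m → c < d
    arith a b c d e m eq a≤ b≤ le refl = +-cancelʳ-≤ e (suc c) d (begin
      suc c + e    ≡⟨ shuffle c e ⟩
      c + (e + 1)  ≡⟨ eq ⟩
      a + b        ≤⟨ +-mono-≤ a≤ b≤ ⟩
      _            ≤⟨ le ⟩
      d + e        ∎)
      where
      open ≤-Reasoning
      shuffle : ∀ c e → suc c + e ≡ c + (e + 1)
      shuffle = solve-∀

  -- Vertices worth a cop

  -- In terms of f: every nonempty W ⊆ U ∖ {v} has f(W) ≤ f(U) − t, and f(U) ≥ t − 1;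
  -- the latter gives the same drop for territories next to v that miss U.
  Drops : ℕ → Subset n → Fin n → Set
  Drops t U v = v ∈ U × n + t ≤ φ U + 1 ×
    (∀ W → Nonempty W → W ⊆ U → v ∉ W → φ W + t ≤ φ U)

  Counterexample : ℕ → Subset n → Fin n → Set
  Counterexample t U v = ∃ λ W → (Nonempty W × W ⊆ U × v ∉ W) × φ U < φ W + t

  drops-or-counterexample : ∀ t {U v} → v ∈ U → n + t ≤ φ U + 1 →
    Drops t U v ⊎ Counterexample t U v
  drops-or-counterexample t {U} {v} v∈U large
    with search (λ W → (nonempty? W ×-dec W ⊆? U ×-dec ¬? (v ∈? W)) ×-dec suc (φ U) ≤? φ W + t)
  ... | inj₁ (W , cex) = inj₂ (W , cex)
  ... | inj₂ none = inj₁ (v∈U , large , λ W ne W⊆U v∉W → ≮⇒≥ λ lt → none W ((ne , (λ {_} → W⊆U) , v∉W) , lt))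

  drops? : ∀ t U v → Dec (Drops t U v)
  drops? t U v with v ∈? U | n + t ≤? φ U + 1
  ... | no v∉U | _ = no (v∉U ∘ proj₁)
  ... | yes _ | no small = no (small ∘ proj₁ ∘ proj₂)
  ... | yes v∈U | yes large with drops-or-counterexample t v∈U large
  ... | inj₁ drops = yes drops
  ... | inj₂ (W , (ne , W⊆U , v∉W) , lt) =
    no λ { (_ , _ , bound) → <⇒≱ lt (bound W ne (λ {_} → W⊆U) v∉W) }

  -- Letting the drop be witnessed in any subset makes the notion monotone in `K`, so a vertex that
  -- is bad for `K` stays bad for every smaller territory.
  Good : ℕ → Subset n → Fin n → Set
  Good t K v = ∃ λ U → U ⊆ K × Drops t U v

  good? : ∀ t K → Decidable (Good t K)
  good? t K v = anySubset? (λ U → U ⊆? K ×-dec drops? t U v)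

  good-mono : ∀ {t U K v} → U ⊆ K → Good t U v → Good t K v
  good-mono U⊆K (V , V⊆U , drops) = V , (λ {_} → U⊆K ∘ V⊆U) , drops

  -- When `K′` meets `U`, supermodularity transfers the drop from `K′ ∩ U` to `K′`, as `K′ ∪ U` lies
  -- in `K` and `φ-mono` bounds it.
  good-drop : ∀ {t K K′ v r} → Connected K → Good t K v →
    K′ ⊆ K → v ∉ K′ → r ∈ K′ → v ~ r → φ K′ + t ≤ φ K
  good-drop {t} {K} {K′} {v} {r} conn (U , U⊆K , v∈U , large , bound) K′⊆K v∉K′ r∈K′ v~r
    with nonempty? (K′ ∩ U)
  ... | yes meet = arith (φ K′) (φ U) (φ (K′ ∪ U)) (φ (K′ ∩ U)) (φ K) t
          (φ-supermodular K′ U)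
          (bound (K′ ∩ U) meet (p∩q⊆q K′ U) (v∉K′ ∘ p∩q⊆p K′ U))
          (φ-mono conn (r , p⊆p∪q U r∈K′) (∪-⊆ K′⊆K U⊆K))
    where
    open ≤-Reasoning
    arith : ∀ a b c d k t → a + b ≤ c + d → d + t ≤ b → c ≤ k → a + t ≤ k
    arith a b c d k t p q s = +-cancelʳ-≤ (b + d) (a + t) k (begin
      a + t + (b + d)    ≡⟨ shuffle a b d t ⟩
      (a + b) + (d + t)  ≤⟨ +-mono-≤ p q ⟩
      (c + d) + b        ≤⟨ +-monoˡ-≤ b (+-monoˡ-≤ d s) ⟩
      (k + d) + b        ≡⟨ shuffle′ k d b ⟩
      k + (b + d)        ∎)
      where
      shuffle : ∀ a b d t → a + t + (b + d) ≡ (a + b) + (d + t)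
      shuffle = solve-∀
      shuffle′ : ∀ k d b → (k + d) + b ≡ k + (b + d)
      shuffle′ = solve-∀
  -- Here `K′` misses `U`, so the edge between `v` and `r` gains one, and f(U) ≥ t - 1 supplies the
  -- rest.
  ... | no apart = +-cancelʳ-≤ n _ _ (begin
      φ K′ + t + n         ≡⟨ shuffle (φ K′) t n ⟩
      φ K′ + (n + t)       ≤⟨ +-monoʳ-≤ (φ K′) large ⟩
      φ K′ + (φ U + 1)     ≡⟨ sym (+-assoc (φ K′) (φ U) 1) ⟩
      φ K′ + φ U + 1       ≤⟨ φ-∪-edge (λ {z} z∈K′ z∈U → apart (z , x∈p∩q⁺ (z∈K′ , z∈U)))
                                 r∈K′ v∈U (~-sym v~r) ⟩
      φ (K′ ∪ U) + n       ≤⟨ +-monoˡ-≤ n (φ-mono conn (r , p⊆p∪q U r∈K′) (∪-⊆ K′⊆K U⊆K)) ⟩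
      φ K + n              ∎)
    where
    open ≤-Reasoning
    shuffle : ∀ a t m → a + t + m ≡ a + (m + t)
    shuffle = solve-∀

  -- In a minimal nonempty set with f ≥ 0, avoiding any vertex `v` forces f ≤ -1, which is a drop of
  -- 1. The search for a smaller such set avoiding `v` performs the descent.
  cyclic⇒good : ∀ {Y} → Nonempty Y → n ≤ φ Y → ∃ λ v → v ∈ Y × Good 1 Y v
  cyclic⇒good {Y} = go (⊂-wellFounded Y)
    where
    go : ∀ {Y} → Acc _⊂_ Y → Nonempty Y → n ≤ φ Y → ∃ λ v → v ∈ Y × Good 1 Y v
    go {Y} (acc rec) (v , v∈Y) n≤φY
      with search (λ W → (nonempty? W ×-dec W ⊆? Y ×-dec ¬? (v ∈? W)) ×-dec n ≤? φ W)
    ... | inj₁ (W , (ne , W⊆Y , v∉W) , n≤φW) =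
      let x , x∈W , good = go (rec ((λ {_} → W⊆Y) , v , v∈Y , v∉W)) ne n≤φW
      in x , W⊆Y x∈W , good-mono W⊆Y good
    ... | inj₂ none = v , v∈Y , Y , (λ {_} u∈ → u∈) , v∈Y , +-monoˡ-≤ 1 n≤φY ,
      λ W ne W⊆Y v∉W → ≤-trans (subst (_≤ n) (+-comm 1 (φ W))
        (≰⇒> λ n≤φW → none W ((ne , (λ {_} → W⊆Y) , v∉W) , n≤φW))) n≤φY

  -- Existence of a vertex with drop two

  module _ {U} (conn : Connected U) (large : n + 2 ≤ φ U)
    (tight : ∀ {w} → w ∈ U → φ (U - w) < φ U)
    (bad : ∀ {x} → x ∈ U → Counterexample 2 U x) where

    n<φ : ∀ {Z} → φ U ≤ φ Z + 1 → n < φ Z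
    n<φ {Z} le = +-cancelʳ-≤ 1 (suc n) (φ Z) (≤-trans (≤-reflexive (shuffle n)) (≤-trans large le))
      where
      shuffle : ∀ m → suc m + 1 ≡ m + 2
      shuffle = solve-∀

    -- If `φ Z` reached `φ U`, `Z` would be nonempty and could absorb neighbours without lowering
    -- `φ` until a single vertex of `U` is missing; there `tight` applies.
    strict : ∀ {Z y} → Z ⊆ U → y ∈ U → y ∉ Z → φ Z < φ U
    strict {Z} = go (⊃-wellFounded Z)
      where
      go : ∀ {Z} → Acc _⊃_ Z → ∀ {y} → Z ⊆ U → y ∈ U → y ∉ Z → φ Z < φ U
      go {Z} (acc rec) {y} Z⊆U y∈U y∉Z with φ U ≤? φ Z
      ... | no φU≰φZ = ≰⇒> φU≰φZ
      ... | yes φU≤φZ with nonempty-of-φ (n<φ {Z} (≤-trans φU≤φZ (m≤m+n _ 1)))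
      ... | z , z∈Z with conn Z (Z⊆U z∈Z) z∈Z y∈U y∉Z
      ... | u , w , (_ , u∈Z) , (w∈U , w∉Z) , u~w
        with any? (λ v → v ∈? U ×-dec ¬? (v ∈? (Z ∪ ⁅ w ⁆)))
      ... | yes (v , v∈U , v∉Z⁺) =
        ≤-<-trans (φ-grow u∈Z w∉Z u~w)
          (go (rec (p⊂p∪⁅x⁆ w∉Z)) (∪-⊆ Z⊆U (⁅⁆-⊆ w∈U)) v∈U v∉Z⁺)
      ... | no full = subst (λ Y → φ Y < φ U) (sym Z≡U-w) (tight w∈U)
        where
        back : U - w ⊆ Z
        back {v} v∈ with v ∈? Z
        ... | yes v∈Z = v∈Z
        ... | no  v∉Z = contradiction (v , p-x⊆p {p = U} v∈ , v∉Z⁺) full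
          where
          v∉Z⁺ : v ∉ Z ∪ ⁅ w ⁆
          v∉Z⁺ v∈Z⁺ with x∈p∪q⁻ Z ⁅ w ⁆ v∈Z⁺
          ... | inj₁ v∈Z = v∉Z v∈Z
          ... | inj₂ v∈w = x∈p─q⇒x∉q {p = U} v∈ v∈w
        Z≡U-w : Z ≡ U - w
        Z≡U-w = ⊆-antisym (λ {v} v∈Z → x∈p∧x≢y⇒x∈p-y (Z⊆U v∈Z) λ { refl → w∉Z v∈Z }) back

    -- Used with `m` for `φ U`, `a` and `b` for two sets of value at least m - 1, `c` for their
    -- intersection (at most m - 2) and `d` for their union; `e` counts a known crossing edge.
    union-large : ∀ a b {c d m} → m ≤ a + 1 → m < b + 2 → c + 1 < m →
      ∀ e → a + b + e ≤ d + c → m + e ≤ d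
    union-large a b {c} {d} {m} p q s e t = +-cancelʳ-≤ (m + c + 3) (m + e) d (begin
      m + e + (m + c + 3)              ≡⟨ shuffle m c e ⟩
      m + suc m + suc (c + 1) + e      ≤⟨ +-monoˡ-≤ e (+-mono-≤ (+-mono-≤ p q) s) ⟩
      (a + 1) + (b + 2) + m + e        ≡⟨ shuffle′ a b m e ⟩
      (a + b + e) + (m + 3)            ≤⟨ +-monoˡ-≤ (m + 3) t ⟩
      (d + c) + (m + 3)                ≡⟨ shuffle″ c d m ⟩
      d + (m + c + 3)                  ∎)
      where
      open ≤-Reasoning
      shuffle : ∀ m c e → m + e + (m + c + 3) ≡ m + suc m + suc (c + 1) + e
      shuffle = solve-∀
      shuffle′ : ∀ a b m e → (a + 1) + (b + 2) + m + e ≡ (a + b + e) + (m + 3)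
      shuffle′ = solve-∀
      shuffle″ : ∀ c d m → (d + c) + (m + 3) ≡ d + (m + c + 3)
      shuffle″ = solve-∀

    -- A minimal proper W with φ W ≥ φ U ∸ 1 meets the counterexample at a boundary
    -- vertex x of W in a smaller set, and supermodularity makes one of the two too large.
    no-heavy : ∀ {W y} → W ⊆ U → y ∈ U → y ∉ W → ¬ (φ U ≤ φ W + 1)
    no-heavy {W} = go (⊂-wellFounded W)
      where
      go : ∀ {W} → Acc _⊂_ W → ∀ {y} → W ⊆ U → y ∈ U → y ∉ W → ¬ (φ U ≤ φ W + 1)
      go {W} (acc rec) {y₀} W⊆U y₀∈U y₀∉W heavy with nonempty-of-φ (n<φ {W} heavy)
      ... | z , z∈W with conn W (W⊆U z∈W) z∈W y₀∈U y₀∉W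
      ... | x , y , (x∈U , x∈W) , (y∈U , y∉W) , x~y with bad x∈U
      ... | W′ , (ne , W′⊆U , x∉W′) , heavy′ with φ U ≤? φ (W ∩ W′) + 1
      ... | yes heavy″ = go (rec (p∩q⊆p W W′ , x , x∈W , x∉W′ ∘ p∩q⊆q W W′))
                            (W⊆U ∘ p∩q⊆p W W′) x∈U (x∉W′ ∘ p∩q⊆q W W′) heavy″
      ... | no light with y ∈? W′
      -- If `y` lies in `W′`, the edge from `x` to `y` pushes the union above `φ U`, against
      -- `φ-mono`; otherwise the union misses `y` and still reaches `φ U`, against `strict`.
      ... | yes y∈W′ = <⇒≱ (<-≤-trans (m<m+n (φ U) (s≤s z≤n))
                (too-large 1 (φ-supermodular-edge x∈W x∉W′ y∈W′ y∉W x~y)))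
              (φ-mono conn (z , p⊆p∪q W′ z∈W) (∪-⊆ W⊆U W′⊆U))
        where too-large = union-large (φ W) (φ W′) heavy heavy′ (≰⇒> light)
      ... | no y∉W′ = <⇒≱ (strict (∪-⊆ W⊆U W′⊆U) y∈U y∉W∪W′)
              (subst (_≤ φ (W ∪ W′)) (+-identityʳ (φ U))
                (too-large 0 (subst (_≤ φ (W ∪ W′) + φ (W ∩ W′)) (sym (+-identityʳ _))
                  (φ-supermodular W W′))))
        where
        too-large = union-large (φ W) (φ W′) heavy heavy′ (≰⇒> light)
        y∉W∪W′ : y ∉ W ∪ W′
        y∉W∪W′ y∈ with x∈p∪q⁻ W W′ y∈
        ... | inj₁ y∈W  = y∉W y∈W
        ... | inj₂ y∈W′ = y∉W′ y∈W′

    impossible : ∀ {x} → ¬ (x ∈ U)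
    impossible x∈U with bad x∈U
    ... | W , (_ , W⊆U , x∉W) , heavy = no-heavy (λ {_} → W⊆U) x∈U x∉W (m<1+n⇒m≤n (subst (φ U <_) (+-suc (φ W) 1) heavy))

  -- Vertices whose removal does not lower `φ` are shed first, which preserves connectivity. Once
  -- every removal costs something, a set without good vertices is refuted by `impossible`.
  bicyclic⇒good : ∀ {U} → Connected U → n + 2 ≤ φ U → ∃ λ v → v ∈ U × Good 2 U v
  bicyclic⇒good {U} = go (⊂-wellFounded U)
    where
    go : ∀ {U} → Acc _⊂_ U → Connected U → n + 2 ≤ φ U → ∃ λ v → v ∈ U × Good 2 U v
    go {U} (acc rec) conn large with any? (λ w → w ∈? U ×-dec φ U ≤? φ (U - w))
    ... | yes (w , w∈U , φU≤) =
      let v , v∈ , good = go (rec (x∈p⇒p-x⊂p w∈U)) (connected-remove conn w∈U φU≤) (≤-trans large φU≤)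
      in v , p-x⊆p {p = U} v∈ , good-mono (p-x⊆p {p = U}) good
    ... | no tight with any? (λ v → v ∈? U ×-dec good? 2 U v)
    ... | yes found = found
    ... | no none = contradiction (proj₂ (nonempty-of-φ (≤-trans (n<n+2 n) large)))
            (impossible conn large (λ {w} w∈U → ≰⇒> λ le → tight (w , w∈U , le)) bad)
      where
      n<n+2 : ∀ m → m < m + 2
      n<n+2 m = subst (suc m ≤_) (+-comm 2 m) (n≤1+n (suc m))
      bad : ∀ {x} → x ∈ U → Counterexample 2 U x
      bad {x} x∈U with drops-or-counterexample 2 x∈U (≤-trans large (m≤m+n (φ U) 1))
      ... | inj₁ drops = contradiction (x , x∈U , U , (λ {_} u∈ → u∈) , drops) none
      ... | inj₂ cex = cex

  -- Strategies

  -- Acyclicity in terms of `φ`: every nonempty induced subgraph has fewer edges than vertices.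
  Forest : Subset n → Set
  Forest U = ∀ {Y} → Nonempty Y → Y ⊆ U → φ Y < n

  -- Every walk in U that starts with the step from p to r and never backtracks is finite.
  data Terminates (U : Subset n) (p r : Fin n) : Set where
    step : (∀ {q} → q ∈ U → r ~ q → q ≢ p → Terminates U r q) → Terminates U p r

  -- Induction by deleting a leaf `v`: a walk either stays in `U - v`, starts at `v` and moves on
  -- into `U - v`, or enters `v` and is stuck.
  forest⇒terminates : ∀ {U} → Forest U → ∀ {p r} → r ∈ U → Terminates U p r
  forest⇒terminates {U} = go (⊂-wellFounded U)
    where
    go : ∀ {U} → Acc _⊂_ U → Forest U → ∀ {p r} → r ∈ U → Terminates U p r
    go {U} (acc rec) forest {p} {r} r∈U with leaf-exists (forest (r , r∈U) (λ u∈ → u∈))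
    ... | v , v∈U , leaf = start
      where
      U⁻ : ∀ {u} → u ∈ U - v → u ∈ U
      U⁻ = p-x⊆p {p = U}
      shorter : ∀ {p r} → r ∈ U - v → Terminates (U - v) p r
      shorter = go (rec (x∈p⇒p-x⊂p v∈U)) (λ ne Y⊆ → forest ne (U⁻ ∘ Y⊆))
      extend : ∀ {p r} → r ∈ U → Terminates (U - v) p r → Terminates U p r
      extend {p} {r} r∈U (step next) = step extended
        where
        extended : ∀ {q} → q ∈ U → r ~ q → q ≢ p → Terminates U r q
        extended {q} q∈U r~q q≢p with q ≟ v
        -- The leaf's only neighbour in `U` is the vertex just left, so no further step is allowed.
        ... | yes refl = step λ w∈U q~w w≢r → contradiction (leaf w∈U r∈U q~w (~-sym r~q)) w≢r
        ... | no q≢v   = extend q∈U (next (x∈p∧x≢y⇒x∈p-y q∈U q≢v) r~q q≢p)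
      start : Terminates U p r
      start with r ≟ v
      ... | no r≢v = extend r∈U (shorter (x∈p∧x≢y⇒x∈p-y r∈U r≢v))
      ... | yes refl = step λ {q} q∈U r~q _ →
        extend q∈U (shorter (x∈p∧x≢y⇒x∈p-y q∈U λ q≡r → ~-irrefl (sym q≡r) r~q))

  -- Territories guarded by fixed cops

  module _ {k : ℕ} where

    -- The free cops will have moved by the time the robber leaves, so a win outside must hold for
    -- every position with the same fixed cops.
    record Agree (s : ℕ) (c c′ : Cops n k) : Set where
      constructor agree
      field same : ∀ i → s ≤ toℕ i → lookup c i ≡ lookup c′ i
    open Agree

    -- The cops numbered below s are free, the others stay put.  Whenever the robber
    -- leaves K, he runs into a cop that stays put or the cops already know how to win.
    Safe : ℕ → Cops n k → Subset n → Set
    Safe s c K = ∀ {u w} → u ∈ K → w ∉ K → u ~ w →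
      (∃ λ i → s ≤ toℕ i × lookup c i ≡ just w) ⊎
      (∀ c′ → Agree s c c′ → WinningStrategy G c′ w)

    Catch : ℕ → Subset n → Set
    Catch s K = ∀ {r} c → r ∈ K → Safe s c K → WinningStrategy G c r

    agree-trans : ∀ {s c c′ c″} → Agree s c c′ → Agree s c′ c″ → Agree s c c″
    agree-trans c≈c′ c′≈c″ = agree λ i s≤i → trans (same c≈c′ i s≤i) (same c′≈c″ i s≤i)

    agree-update : ∀ {s i} → toℕ i < s → ∀ c {x} → Agree s c (c [ i ]≔ x)
    agree-update i<s c = agree λ j s≤j → sym (lookup∘update′ (λ { refl → <⇒≱ i<s s≤j }) c _)

    agree-mono : ∀ {s t c c′} → s ≤ t → Agree s c c′ → Agree t c c′
    agree-mono s≤t c≈c′ = agree λ i t≤i → same c≈c′ i (≤-trans s≤t t≤i)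

    safe-agree : ∀ {s c c′ K} → Agree s c c′ → Safe s c K → Safe s c′ K
    safe-agree c≈c′ safe u∈K w∉K u~w with safe u∈K w∉K u~w
    ... | inj₁ (i , s≤i , at-w) = inj₁ (i , s≤i , trans (sym (same c≈c′ i s≤i)) at-w)
    ... | inj₂ exit = inj₂ λ c″ c′≈c″ → exit c″ (agree-trans c≈c′ c′≈c″)

    occupied : ∀ {c : Cops n k} {i w} → lookup c i ≡ just w → just w Vec.∈ c
    occupied {c} {i} at-w = subst (Vec._∈ c) at-w (∈-lookup i c)

    leave : ∀ {s c c′ K u w} → Safe s c K → Agree s c c′ → u ∈ K → w ∉ K → u ~ w →
      ¬ (just w Vec.∈ c′) → WinningStrategy G c′ w
    leave safe c≈c′ u∈K w∉K u~w free with safe u∈K w∉K u~w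
    ... | inj₁ (i , s≤i , at-w) = contradiction (occupied (trans (sym (same c≈c′ i s≤i)) at-w)) free
    ... | inj₂ exit = exit _ c≈c′

    -- Two free cops alternate on the robber's trail, so that he can never turn back.
    catch-forest : ∀ {s K} → 2 ≤ s → s ≤ k → Forest K → Catch s K
    catch-forest {s} {K} 2≤s s≤k forest {r} c r∈K safe = turn (fly i₀) reply
      where
      index : ∀ {m} → m < 2 → ∃ λ (i : Fin k) → toℕ i ≡ m
      index m<2 = let m<k = ≤-trans m<2 (≤-trans 2≤s s≤k) in fromℕ< m<k , toℕ-fromℕ< m<k

      i₀ i₁ : Fin k
      i₀ = proj₁ (index {0} (s≤s z≤n))
      i₁ = proj₁ (index {1} ≤-refl)

      i₀<s : toℕ i₀ < s
      i₀<s = subst (_< s) (sym (proj₂ (index {0} (s≤s z≤n)))) (≤-trans (s≤s z≤n) 2≤s)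
      i₁<s : toℕ i₁ < s
      i₁<s = subst (_< s) (sym (proj₂ (index {1} ≤-refl))) 2≤s

      i₀≢i₁ : i₀ ≢ i₁
      i₀≢i₁ eq with trans (sym (proj₂ (index {0} (s≤s z≤n)))) (trans (cong toℕ eq) (proj₂ (index {1} ≤-refl)))
      ... | ()

      chase : ∀ {p r i j} → Terminates K p r → toℕ i < s → toℕ j < s → i ≢ j →
        ∀ c → lookup c i ≡ just p → r ∈ K → Safe s c K → WinningStrategy G c r
      chase {p} {r} {i} {j} (step next) i<s j<s i≢j c at-p r∈K safe = turn (fly j) onward
        where
        onward : ∀ q → RobberMove G (c [ j ]≔ just r) r q → WinningStrategy G (c [ j ]≔ just r) q
        onward q (r~q , free) with q ∈? K
        ... | no q∉K = leave safe (agree-update j<s c) r∈K q∉K r~q free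
        ... | yes q∈K = chase
          -- Cop `i` stands on `p`, which rules out turning back.
          (next q∈K r~q λ { refl → free (occupied (trans (lookup∘update′ i≢j c _) at-p)) })
          -- The cops swap roles: `j` now guards the vertex just left, and `i` flies next.
          j<s i<s (i≢j ∘ sym) _ (lookup∘update j c _) q∈K (safe-agree (agree-update j<s c) safe)

      reply : ∀ q → RobberMove G (c [ i₀ ]≔ just r) r q → WinningStrategy G (c [ i₀ ]≔ just r) q
      reply q (r~q , free) with q ∈? K
      ... | no q∉K = leave safe (agree-update i₀<s c) r∈K q∉K r~q free
      ... | yes q∈K = chase (forest⇒terminates forest q∈K) i₀<s i₁<s i₀≢i₁ _
        (lookup∘update i₀ c _) q∈K (safe-agree (agree-update i₀<s c) safe)

    -- Cop number `s` lands on `v` and joins the fixed ones. The robber is left with a component of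
    -- `K - v`, whose `φ` is lower by `t` according to `good-drop`.
    catch-place : ∀ {t s K v} → s < k → Connected K → Good t K v → v ∈ K →
      (∀ {K′} → Connected K′ → φ K′ + t ≤ φ K → Catch s K′) →
      ∀ c → Safe (suc s) c K → WinningStrategy G c v
    catch-place {t} {s} {K} {v} s<k conn good v∈K ih c safe = turn (fly i) reply
      where
      i : Fin k
      i = fromℕ< s<k
      i≡s : toℕ i ≡ s
      i≡s = toℕ-fromℕ< s<k
      c⁺ : Cops n k
      c⁺ = c [ i ]≔ just v
      c≈c⁺ : Agree (suc s) c c⁺
      c≈c⁺ = agree-update (s≤s (≤-reflexive i≡s)) c

      reply : ∀ r → RobberMove G c⁺ v r → WinningStrategy G c⁺ r
      reply r (v~r , free) with r ∈? K
      ... | no r∉K = leave safe c≈c⁺ v∈K r∉K v~r free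
      ... | yes r∈K = ih connected
          (good-drop conn good (proj₁ ∘ within) (λ v∈K′ → proj₂ (within v∈K′) refl) root v~r)
          c⁺ root safe⁺
        where
        open Component (component (λ u → u ∈? K ×-dec ¬? (u ≟ v))
          (r∈K , λ r≡v → ~-irrefl (sym r≡v) v~r)) renaming (K to K′)
        safe⁺ : Safe s c⁺ K′
        safe⁺ {u} {w} u∈K′ w∉K′ u~w with w ≟ v | w ∈? K
        -- The only way out of `K′` inside `K` is `v`, where the new cop stands.
        ... | yes refl | _ = inj₁ (i , ≤-reflexive (sym i≡s) , lookup∘update i c _)
        ... | no w≢v | yes w∈K = contradiction (closed u∈K′ (w∈K , w≢v) u~w) w∉K′
        ... | no _ | no w∉K with safe-agree c≈c⁺ safe (proj₁ (within u∈K′)) w∉K u~w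
        ... | inj₁ (j , s<j , at-w) = inj₁ (j , <⇒≤ s<j , at-w)
        ... | inj₂ exit = inj₂ λ c′ c⁺≈c′ → exit c′ (agree-mono (n≤1+n s) c⁺≈c′)

    -- No cop is spent while the robber avoids good vertices: he stays in a component `U` of bad
    -- ones, and his stepping onto a good vertex is recorded in `Safe` as an exit that already wins.
    catch-step : ∀ {t s K} → s < k → Connected K →
      (∀ {K′} → Connected K′ → φ K′ + t ≤ φ K → Catch s K′) →
      (∀ {U} → Connected U → U ⊆ K → (∀ {v} → v ∈ U → ¬ Good t K v) → Catch (suc s) U) →
      Catch (suc s) K
    catch-step {t} {s} {K} s<k conn ih bad-case {r} c r∈K safe with good? t K r
    ... | yes good = catch-place s<k conn good r∈K ih c safe
    ... | no bad = bad-case connected (λ {_} → proj₁ ∘ within) (proj₂ ∘ within) c root safe′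
      where
      open Component (component (λ u → u ∈? K ×-dec ¬? (good? t K u)) (r∈K , bad)) renaming (K to U)
      safe′ : Safe (suc s) c U
      safe′ {u} {w} u∈U w∉U u~w with w ∈? K | good? t K w
      ... | no w∉K | _ = safe (proj₁ (within u∈U)) w∉K u~w
      ... | yes w∈K | no bad-w = contradiction (closed u∈U (w∈K , bad-w) u~w) w∉U
      ... | yes w∈K | yes good = inj₂ λ c′ c≈c′ →
        catch-place s<k conn good w∈K ih c′ (safe-agree c≈c′ safe)

    -- Two cops are reserved for the forest chase and each of the other `s` pays for a drop of 1. At
    -- `s = 0`, f(K) < 0 makes `K` a forest by `φ-mono`.
    catch-low : ∀ s {K} → 2 + s ≤ k → Connected K → φ K < n + s → Catch (2 + s) K
    catch-low zero {K} 2≤k conn low =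
      catch-forest ≤-refl 2≤k λ ne Y⊆K →
        ≤-<-trans (φ-mono conn ne Y⊆K) (subst (φ K <_) (+-identityʳ n) low)
    catch-low (suc s) {K} s<k conn low = catch-step {t = 1} s<k conn
      (λ {K′} conn′ drop → catch-low s (<⇒≤ s<k) conn′
        (+-cancelʳ-< 1 (φ K′) (n + s) (≤-<-trans drop (subst (φ K <_) (shuffle n s) low))))
      (λ conn′ U⊆K bad → catch-forest (s≤s (s≤s z≤n)) s<k λ ne Y⊆U → ≰⇒> λ n≤φ →
        let v , v∈Y , good = cyclic⇒good ne n≤φ
        in bad (Y⊆U v∈Y) (good-mono (λ {_} → U⊆K ∘ Y⊆U) good))
      where
      shuffle : ∀ a b → a + suc b ≡ a + b + 1
      shuffle = solve-∀

    -- Each of `q` cops pays for a drop of 2; the remaining four handle f ≤ 1 through `catch-low 2`.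
    catch-connected : ∀ q {K} → 4 + q ≤ k → Connected K → φ K < n + (2 + (q + q)) → Catch (4 + q) K
    catch-connected zero    4≤k conn bound = catch-low 2 4≤k conn bound
    catch-connected (suc q) {K} q<k conn bound = catch-step {t = 2} q<k conn
      (λ {K′} conn′ drop → catch-connected q (<⇒≤ q<k) conn′
        (+-cancelʳ-< 2 (φ K′) _ (≤-<-trans drop (subst (φ K <_) (shuffle n q) bound))))
      -- The bad part has f ≤ 1; the weaker bound f < 3 + q is used because it matches the 5 + q
      -- cops that are still free.
      (λ {U} conn′ U⊆K bad → catch-low (3 + q) q<k conn′ (≰⇒> λ large →
        let v , v∈U , good = bicyclic⇒good conn′
              (≤-trans (+-monoʳ-≤ n (s≤s (s≤s z≤n))) large)
        in bad v∈U (good-mono (λ {_} → U⊆K) good)))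
      where
      shuffle : ∀ a q → a + (2 + (suc q + suc q)) ≡ a + (2 + (q + q)) + 2
      shuffle = solve-∀

  -- The count for cubic graphs

  -- Twice `φ` is at most 3n, and one of these three n is below 4⌊n/4⌋ + 4; halving gives f(K) <
  -- 2⌊n/4⌋ + 2.
  few-edges : Regular 3 G → ∀ K → φ K < n + (2 + (n / 4 + n / 4))
  few-edges reg K = ≰⇒> λ large → <⇒≱ (3n< n (n % 4) (n / 4) (m≡m%n+[m/n]*n n 4) (m%n<n n 4))
    (≤-trans (+-mono-≤ large large) (2φ≤3n reg K))
    where
    3n< : ∀ m r q → m ≡ r + q * 4 → r < 4 → m * 3 < (m + (2 + (q + q))) + (m + (2 + (q + q)))
    3n< m r q eq r<4 = begin-strict
      m * 3                                        ≡⟨ split m ⟩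
      m + m + m                                    ≡⟨ cong (m + m +_) eq ⟩
      m + m + (r + q * 4)                          <⟨ +-monoʳ-< (m + m) (+-monoˡ-< (q * 4) r<4) ⟩
      m + m + (4 + q * 4)                          ≡⟨ shuffle m q ⟩
      (m + (2 + (q + q))) + (m + (2 + (q + q)))    ∎
      where
      open ≤-Reasoning
      split : ∀ m → m * 3 ≡ m + m + m
      split = solve-∀
      shuffle : ∀ m q → m + m + (4 + q * 4) ≡ (m + (2 + (q + q))) + (m + (2 + (q + q)))
      shuffle = solve-∀

  cubic-cops-suffice : Regular 3 G → CopsSuffice G (n / 4 + 4)
  cubic-cops-suffice reg start =
    catch-connected (n / 4) (≤-reflexive (+-comm 4 (n / 4))) connected (few-edges reg K) _ root
      -- The first territory is a whole component of the graph, so no edge leaves it, and all cops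
      -- are free.
      λ u∈K w∉K u~w → contradiction (closed u∈K tt u~w) w∉K
    where open Component (component {P = λ _ → Unit} (λ _ → yes tt) tt)

theorem3 : (n : ℕ) (G : Graph n) → Regular 3 G →
    CopsSuffice G (n / 4 + 4) ×
    (∀ e → IsEntanglement G e → e ≤ n / 4 + 4)
theorem3 n G reg = suffice , λ e (_ , least) → least _ suffice
  where suffice = CopStrategy.cubic-cops-suffice G reg
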